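{- Let $G$ be a graph on $n \geq 3$ vertices such that $G$ and its complement $\overline{G}$ are both connected. Then $$b_{\rm g}(G)\, b_{\rm g}(\overline{G}) \leq n+18.$$
   Context: All graphs are finite, simple and undirected. The burning game on a graph $G$ is played by two players, Burner and Staller, in rounds $t=1,2,3,\dots$. Initially (round $0$) all vertices are unburned. Each round $t\ge 1$ consists of two phases: first, in the spreading phase, every unburned vertex having a burning neighbor starts to burn (fire spreads simultaneously, by distance one, from all burning vertices); then, in the selection phase, if unburned vertices remain, the player whose turn it is chooses one unburned vertex, which starts to burn. Burning vertices stay burning forever. The players alternate: one of them selects in the odd rounds, the other in the even rounds. The game ends in the first round in which all vertices of $G$ are burning (possibly already after the spreading phase of that round). Burner wants to minimize the number of rounds and Staller wants to maximize it. If both play optimally, the number of rounds is denoted $b_{\rm g}(G)$ (the game burning number) when Burner makes the first move (selects in round 1). -}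

module Defs where

open import Data.Fin.Base using (Fin)
open import Data.Fin.Properties using (_≟_; any?; all?; ¬∀⟶∃¬)
open import Data.Fin.Subset using (Subset; _∈_; _∉_; _⊃_; _∪_; ⁅_⁆; ⊥)
open import Data.Fin.Subset.Induction using (⊃-wellFounded)
open import Data.Fin.Subset.Properties using (_∈?_; p⊆p∪q; q⊆p∪q; x∈⁅x⁆)
open import Data.List.Base using (List; map; mapMaybe; allFin)
open import Data.List.Extrema.Nat using (min; max)
open import Data.Maybe.Base as Maybe using ()
open import Data.Nat.Base using (ℕ; suc)
open import Data.Product.Base using (∃-syntax; _×_; _,_)
open import Data.Vec.Base using (tabulate)
open import Function.Base using (_∘_)
open import Induction.WellFounded using (Acc; acc)
open import Level using (0ℓ)
open import Relation.Binary.Construct.Closure.ReflexiveTransitive using (Star)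
open import Relation.Binary.Core using (Rel)
open import Relation.Binary.Definitions using (Decidable; Irreflexive; Symmetric)
open import Relation.Binary.PropositionalEquality.Core using (_≡_; _≢_; ≢-sym)
open import Relation.Nullary.Decidable using (does; yes; no; ¬?; _×-dec_; dec⇒maybe)
open import Relation.Nullary.Negation using (¬_)

record Graph (n : ℕ) : Set₁ where
  field
    Adj    : Rel (Fin n) 0ℓ
    adj?   : Decidable Adj
    sym    : Symmetric Adj
    irrefl : Irreflexive _≡_ Adj

complement : ∀ {n} → Graph n → Graph n
complement G = record
  { Adj    = λ u v → u ≢ v × ¬ Adj u v
  ; adj?   = λ u v → ¬? (u ≟ v) ×-dec ¬? (adj? u v)
  ; sym    = λ (u≢v , ¬uv) → ≢-sym u≢v , ¬uv ∘ sym
  ; irrefl = λ u≡v (u≢v , _) → u≢v u≡v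
  }
  where open Graph G

Connected : ∀ {n} → Graph n → Set
Connected G = ∀ u v → Star (Graph.Adj G) u v

data Player : Set where
  burner staller : Player

opponent : Player → Player
opponent burner  = staller
opponent staller = burner

Move : ∀ {n} → Subset n → Set
Move B = ∃[ v ] v ∉ B

moves : ∀ {n} (B : Subset n) → List (Move B)
moves {n} B =
  mapMaybe (λ v → Maybe.map (v ,_) (dec⇒maybe (¬? (v ∈? B)))) (allFin n)

someMove : ∀ {n} (B : Subset n) → ¬ (∀ v → v ∈ B) → Move B
someMove {n} B = ¬∀⟶∃¬ n (_∈ B) (_∈? B)

-- min and max are taken of a default value together with a list.
optimum : Player → ℕ → List ℕ → ℕ
optimum burner  = min
optimum staller = max

module BurningGame {n} (G : Graph n) where
  open Graph G

  spread : Subset n → Subset n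
  spread B = B ∪ tabulate λ v → does (any? λ u → (u ∈? B) ×-dec adj? u v)

  select : (B : Subset n) → Move (spread B) → Subset n
  select B (v , _) = spread B ∪ ⁅ v ⁆

  select-⊃ : ∀ B (m : Move (spread B)) → select B m ⊃ B
  select-⊃ B (v , v∉) =
      p⊆p∪q ⁅ v ⁆ ∘ p⊆p∪q _
    , v , q⊆p∪q (spread B) ⁅ v ⁆ (x∈⁅x⁆ v) , v∉ ∘ p⊆p∪q _

  -- The number of further rounds under optimal play, when exactly the vertices
  -- in B are burning at the end of a round and p is to select in the next one.
  -- The default passed to optimum is the value of a legal move, so it does not
  -- affect the result.
  roundsAcc : Player → (B : Subset n) → Acc _⊃_ B → ℕ
  roundsAcc p B (acc rs) with all? (_∈? B)
  ... | yes _ = 0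
  ... | no  _ with all? (_∈? spread B)
  ...   | yes _    = 1
  ...   | no  ¬all =
    suc (optimum p (play (someMove _ ¬all)) (map play (moves (spread B))))
    where
    play : Move (spread B) → ℕ
    play m = roundsAcc (opponent p) (select B m) (rs (select-⊃ B m))

  rounds : Player → Subset n → ℕ
  rounds p B = roundsAcc p B (⊃-wellFounded B)

gameBurningNumber : ∀ {n} → Graph n → ℕ
gameBurningNumber G = rounds burner ⊥
  where open BurningGame G

{-# OPTIONS --safe #-}

-- If two vertices of G are at distance more than 3, then the complement has
-- diameter at most 2, so it burns within 3 rounds; otherwise neither graph needs
-- more than 4.  It remains to burn a connected graph within q + 6 rounds, where
-- q = ⌊n / 3⌋.  Fix a spanning tree.  When t rounds are left, Burner selects the
-- ancestor, t - 1 levels up, of a deepest vertex among those not yet promised to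
-- burn.  Everything below it burns in time, and this promises at least t further
-- vertices.  As Burner moves in every other round, three such moves are enough:
-- (q + 6) + (q + 4) + (q + 2) ≥ n.
module Submission where

open import Defs
open import Data.Nat.Base using (ℕ; _+_; _*_; _≤_)

open import Data.Empty using (⊥-elim)
open import Data.Fin.Base using (Fin; zero)
open import Data.Fin.Properties as Fin using (any?; all?; ¬∀⟶∃¬)
open import Data.Fin.Subset using (Subset; _∈_; _∉_; _⊆_; _-_; ∣_∣; ⁅_⁆; ⊥)
open import Data.Fin.Subset.Induction using (⊃-wellFounded)
open import Data.Fin.Subset.Properties
  using (_∈?_; p⊆p∪q; q⊆p∪q; x∈⁅x⁆; ∈⊤; ∣⊤∣≡n; p⊆q⇒∣p∣≤∣q∣; nonempty?;
         x∈p∧x≢y⇒x∈p-y; x∈p⇒∣p-x∣<∣p∣)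
open import Data.List.Base using (List; allFin; filter)
open import Data.List.Extrema.Nat using (argmax; argmax-all; f[xs]≤f[argmax]; min≤v⁺; max≤v⁺)
open import Data.List.Membership.Propositional.Properties using (∈-allFin; ∈-filter⁺)
open import Data.List.Relation.Unary.All as All using (All)
open import Data.List.Relation.Unary.All.Properties as All using (all-filter)
open import Data.List.Relation.Unary.Any as Any using (Any)
open import Data.List.Relation.Unary.Any.Properties as Any using (mapMaybe⁺)
open import Data.Maybe.Base as Maybe using (Maybe)
open import Data.Maybe.Relation.Unary.Any as MaybeAny using (just)
open import Data.Nat.Base using (zero; suc; pred; _∸_; _<_; z≤n; s≤s; z<s; s<s; _/_; _%_)
open import Data.Nat.DivMod using (m≡m%n+[m/n]*n; m%n<n; m/n*n≤m)
open import Data.Nat.GeneralisedArithmetic using (iterate)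
open import Data.Nat.Properties
open import Data.Nat.Solver using (module +-*-Solver)
open import Data.Product.Base using (∃-syntax; _×_; _,_; proj₁; proj₂; map₂)
open import Data.Sum.Base as Sum using (_⊎_; inj₁; inj₂)
open import Data.Vec.Base using (tabulate)
open import Data.Vec.Properties using (lookup∘tabulate; []=⇒lookup; lookup⇒[]=)
open import Function.Base using (_∘_)
open import Induction.WellFounded using (acc)
open import Relation.Binary.Construct.Closure.ReflexiveTransitive using (Star; ε; _◅_)
open import Relation.Binary.PropositionalEquality
  using (_≡_; _≢_; refl; sym; trans; cong; subst; module ≡-Reasoning)
open import Relation.Nullary using (¬_; Dec; yes; no; does; contradiction)
open import Relation.Nullary.Decidable
  using (¬?; _×-dec_; _⊎-dec_; dec⇒maybe; dec-true)
open import Relation.Unary using (Pred; Decidable)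
open import Level using (0ℓ)

-- Finite subsets, extrema and legal moves.

module _ {n} {P : Pred (Fin n) 0ℓ} (P? : Decidable P) where

  subset : Subset n
  subset = tabulate (does ∘ P?)

  ∈-subset⁺ : ∀ {v} → P v → v ∈ subset
  ∈-subset⁺ {v} Pv = lookup⇒[]= v _ (trans (lookup∘tabulate _ v) (dec-true (P? v) Pv))

  ∈-subset⁻ : ∀ {v} → v ∈ subset → P v
  ∈-subset⁻ {v} v∈ with P? v | trans (sym (lookup∘tabulate (does ∘ P?) v)) ([]=⇒lookup v∈)
  ... | yes Pv | _ = Pv

least : ∀ {P : Pred ℕ 0ℓ} → Decidable P → ∀ {k} → P k → ∃[ m ] P m × (∀ {j} → P j → m ≤ j)
least P? {k} Pk with P? 0
... | yes P0 = 0 , P0 , λ _ → z≤n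
least P? {zero}  Pk | no ¬P0 = contradiction Pk ¬P0
least {P} P? {suc k} Pk | no ¬P0 with m , Pm , m≤ ← least (P? ∘ suc) Pk = suc m , Pm , above
  where
  above : ∀ {j} → P j → suc m ≤ j
  above {zero}  P0 = contradiction P0 ¬P0
  above {suc j} Pj = s≤s (m≤ Pj)

maximiser : ∀ {n} (f : Fin n → ℕ) (R : Subset n) {x} → x ∈ R →
            ∃[ v ] v ∈ R × (∀ {w} → w ∈ R → f w ≤ f v)
maximiser {n} f R {x} x∈R =
    argmax f x vs
  , argmax-all f x∈R (all-filter (_∈? R) (allFin n))
  , λ w∈R → All.lookup (f[xs]≤f[argmax] x vs) (∈-filter⁺ (_∈? R) (∈-allFin _) w∈R)
  where
  vs : List (Fin n)
  vs = filter (_∈? R) (allFin n)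

iterate-iterate : ∀ {A : Set} (f : A → A) x i j → iterate f (iterate f x i) j ≡ iterate f x (i + j)
iterate-iterate f x zero    j = refl
iterate-iterate f x (suc i) j = iterate-iterate f (f x) i j

-- Burner's value is a minimum over this list, so a bound for one chosen move carries over once the
-- list is known to contain it.
moves-complete : ∀ {n} (B : Subset n) {v} → v ∉ B → Any (λ m → proj₁ m ≡ v) (moves B)
moves-complete {n} B {v} v∉B =
  mapMaybe⁺ move? (allFin n) (Any.map⁺ (Any.map legal (∈-allFin v)))
  where
  move? : Fin n → Maybe (Move B)
  move? w = Maybe.map (w ,_) (dec⇒maybe (¬? (w ∈? B)))

  legal : ∀ {w} → v ≡ w → MaybeAny.Any (λ m → proj₁ m ≡ v) (move? w)
  legal {w} refl with w ∈? B
  ... | yes w∈B = contradiction w∈B v∉B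
  ... | no  _   = just refl

optimum≤ : ∀ p {d ds t} → d ≤ t → All (_≤ t) ds → optimum p d ds ≤ t
optimum≤ burner  {d} {ds} d≤ _ = min≤v⁺ d ds (inj₁ d≤)
optimum≤ staller d≤ ds≤ = max≤v⁺ d≤ ds≤

-- Distances and breadth-first spanning trees.

module Distance {n} (G : Graph n) where
  open Graph G renaming (sym to Adj-sym)

  Step : Fin n → Fin n → Set
  Step u v = u ≡ v ⊎ Adj u v

  step? : ∀ u v → Dec (Step u v)
  step? u v = u Fin.≟ v ⊎-dec adj? u v

  -- `Step` also allows standing still, so `Near k` means distance at most `k`. The target is a
  -- predicate, to serve for a single vertex as well as for the burning set.
  Near : ℕ → Pred (Fin n) 0ℓ → Pred (Fin n) 0ℓ
  Near zero    P v = P v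
  Near (suc k) P v = ∃[ u ] Step u v × Near k P u

  near? : ∀ k {P} → Decidable P → Decidable (Near k P)
  near? zero    P? v = P? v
  near? (suc k) P? v = any? λ u → step? u v ×-dec near? k P? u

  near-map : ∀ k {P Q} → (∀ {v} → P v → Q v) → ∀ {v} → Near k P v → Near k Q v
  near-map zero    f = f
  near-map (suc k) f = map₂ (map₂ (near-map k f))

  near-mono : ∀ {j k P v} → j ≤ k → Near j P v → Near k P v
  near-mono {k = zero}      z≤n       Pv            = Pv
  near-mono {k = suc k} {P} z≤n       Pv            = _ , inj₁ refl , near-mono {0} {k} {P} z≤n Pv
  near-mono {suc j} {suc k} (s≤s j≤k) (u , uv , Nu) = u , uv , near-mono {j} {k} j≤k Nu

  near-star : ∀ {u v} → Star Adj v u → ∃[ k ] Near k (_≡ u) v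
  near-star ε          = 0 , refl
  near-star (vw ◅ wu) with k , Nw ← near-star wu = suc k , _ , inj₂ (Adj-sym vw) , Nw

  -- `parent` is total: as `pred 0` is `0`, the last two fields force the root to be its own parent.
  record SpanningTree : Set where
    field
      root         : Fin n
      parent       : Fin n → Fin n
      depth        : Fin n → ℕ
      parent-step  : ∀ v → Step (parent v) v
      depth-parent : ∀ v → depth (parent v) ≡ pred (depth v)
      depth≡0      : ∀ {v} → depth v ≡ 0 → v ≡ root

  spanningTree : Connected G → Fin n → SpanningTree
  spanningTree conn r = record
    { root         = r
    ; parent       = λ v → proj₁ (up v)
    ; depth        = depth
    ; parent-step  = λ v → proj₁ (proj₂ (up v))
    ; depth-parent = λ v → proj₂ (proj₂ (up v))
    ; depth≡0      = λ {v} eq → subst (λ k → Near k (_≡ r) v) eq (near-depth v)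
    }
    where
    distance : ∀ v → ∃[ m ] Near m (_≡ r) v × (∀ {j} → Near j (_≡ r) v → m ≤ j)
    distance v = let k , Nv = near-star (conn v r) in least (λ k → near? k (Fin._≟ r) v) {k} Nv

    depth : Fin n → ℕ
    depth = proj₁ ∘ distance

    near-depth : ∀ v → Near (depth v) (_≡ r) v
    near-depth = proj₁ ∘ proj₂ ∘ distance

    depth-min : ∀ v {j} → Near j (_≡ r) v → depth v ≤ j
    depth-min = proj₂ ∘ proj₂ ∘ distance

    -- `m` abstracts `depth v`, so that a shortest walk to `r` can be split at its first step.
    -- Minimality at both `u` and `v` then fixes the depth of `u`.
    up′ : ∀ v m → depth v ≡ m → Near m (_≡ r) v → ∃[ u ] Step u v × depth u ≡ pred m
    up′ v zero    eq _             = v , inj₁ refl , eq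
    up′ v (suc m) eq (u , uv , Nu) = u , uv , ≤-antisym (depth-min u Nu) (≤-pred
      (≤-trans (≤-reflexive (sym eq)) (depth-min v (u , uv , near-depth u))))

    up : ∀ v → ∃[ u ] Step u v × depth u ≡ pred (depth v)
    up v = up′ v (depth v) refl (near-depth v)

-- Upper bounds on the value of the game.

module Game {n} (G : Graph n) where
  open Graph G using (adj?)
  open BurningGame G
  open Distance G public

  spread-step : ∀ {B u v} → u ∈ B → Step u v → v ∈ spread B
  spread-step {B} u∈B (inj₁ refl) = p⊆p∪q _ u∈B
  spread-step {B} {u} u∈B (inj₂ uv) = q⊆p∪q B _
    (∈-subset⁺ (λ v → any? λ u → (u ∈? B) ×-dec adj? u v) (u , u∈B , uv))

  -- Spreading takes up the last step of the walk, the one next to the fire.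
  near-spread : ∀ k {B v} → Near (suc k) (_∈ B) v → Near k (_∈ spread B) v
  near-spread zero    (u , uv , u∈B) = spread-step u∈B uv
  near-spread (suc k) (u , uv , Nu)  = u , uv , near-spread k Nu

  spread⊆select : ∀ {B} m → spread B ⊆ select B m
  spread⊆select (v , _) = p⊆p∪q ⁅ v ⁆

  ∈-select : ∀ {B} m → proj₁ m ∈ select B m
  ∈-select {B} (v , _) = q⊆p∪q (spread B) _ (x∈⁅x⁆ v)

  -- Termination proofs are universally quantified, so that bounds do not depend on them.
  infix 4 rounds⟨_,_⟩≤_
  rounds⟨_,_⟩≤_ : Player → Subset n → ℕ → Set
  rounds⟨ p , B ⟩≤ t = ∀ a → roundsAcc p B a ≤ t

  rounds-full : ∀ p {B} t → (∀ v → v ∈ B) → rounds⟨ p , B ⟩≤ t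
  rounds-full p {B} t full (acc rs) with all? (_∈? B)
  ... | yes _     = z≤n
  ... | no  ¬full = contradiction full ¬full

  -- Every selection results in a superset of `spread B`, so a bound for all supersets covers any
  -- choice of either player.
  any-move : ∀ p {B t} → (∀ {B′} → spread B ⊆ B′ → rounds⟨ opponent p , B′ ⟩≤ t) →
             rounds⟨ p , B ⟩≤ suc t
  any-move p {B} good (acc rs) with all? (_∈? B)
  ... | yes _ = z≤n
  ... | no  _ with all? (_∈? spread B)
  ...   | yes _ = s≤s z≤n
  ...   | no  ¬all = s≤s (optimum≤ p
    (good-play (someMove (spread B) ¬all)) (All.map⁺ (All.universal good-play (moves (spread B)))))
    where
    good-play : ∀ m → roundsAcc (opponent p) (select B m) (rs (select-⊃ B m)) ≤ _
    good-play m = good (spread⊆select m) (rs (select-⊃ B m))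

  burner-move : ∀ {B t} v → (∀ {B′} → spread B ⊆ B′ → v ∈ B′ → rounds⟨ staller , B′ ⟩≤ t) →
                rounds⟨ burner , B ⟩≤ suc t
  burner-move {B} v good a with v ∈? spread B
  -- A vertex that burns after spreading cannot be selected, but then every move leads to a set
  -- containing it.
  burner-move {B} v good a        | yes v∈ = any-move burner (λ ⊆B′ → good ⊆B′ (⊆B′ v∈)) a
  burner-move {B} v good (acc rs) | no  v∉ with all? (_∈? B)
  ... | yes _ = z≤n
  ... | no  _ with all? (_∈? spread B)
  ...   | yes _ = s≤s z≤n
  ...   | no  _ = s≤s (min≤v⁺ _ _ (inj₂ (Any.map⁺ (Any.map
                    (λ { {m} refl → good (spread⊆select m) (∈-select m) (rs (select-⊃ B m)) })
                    (moves-complete (spread B) v∉)))))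

  burn-out : ∀ p t {B} → (∀ v → Near t (_∈ B) v) → rounds⟨ p , B ⟩≤ t
  burn-out p zero    near = rounds-full p zero near
  burn-out p (suc t) near = any-move p λ ⊆B′ →
    burn-out (opponent p) t (λ v → near-map t ⊆B′ (near-spread t (near v)))

  gameBurningNumber≤1+ecc : ∀ t c → (∀ v → Near t (_≡ c) v) → gameBurningNumber G ≤ suc t
  gameBurningNumber≤1+ecc t c near = burner-move c
    (λ _ c∈B → burn-out staller t (λ v → near-map t (λ { refl → c∈B }) (near v)))
    (⊃-wellFounded ⊥)

  -- Burner's strategy along a spanning tree.

  module TreeStrategy (T : SpanningTree) where
    open SpanningTree T

    ancestor : Fin n → ℕ → Fin n
    ancestor = iterate parent

    depth-ancestor : ∀ v k → depth (ancestor v k) ≡ depth v ∸ k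
    depth-ancestor v zero    = refl
    depth-ancestor v (suc k) = begin
      depth (ancestor (parent v) k) ≡⟨ depth-ancestor (parent v) k ⟩
      depth (parent v) ∸ k          ≡⟨ cong (_∸ k) (depth-parent v) ⟩
      pred (depth v) ∸ k            ≡⟨ cong (_∸ k) (pred[n]≡n∸1 {depth v}) ⟩
      depth v ∸ 1 ∸ k               ≡⟨ ∸-+-assoc (depth v) 1 k ⟩
      depth v ∸ suc k               ∎
      where
      open ≡-Reasoning
      pred[n]≡n∸1 : ∀ {n} → pred n ≡ n ∸ 1
      pred[n]≡n∸1 {zero}  = refl
      pred[n]≡n∸1 {suc n} = refl

    near-ancestor : ∀ k {P v} → P (ancestor v k) → Near k P v
    near-ancestor zero    Pv = Pv
    near-ancestor (suc k) Pv = parent _ , parent-step _ , near-ancestor k Pv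

    near-root : ∀ {k v} → depth v ≤ k → Near k (_≡ root) v
    near-root {k} {v} d≤k =
      near-ancestor k (depth≡0 (trans (depth-ancestor v k) (m≤n⇒m∸n≡0 d≤k)))

    -- Keeps all ancestors of a vertex of `R` inside `R`, so that a Burner move can remove a whole
    -- path from it.
    ParentClosed : Subset n → Set
    ParentClosed R = ∀ {v} → v ∈ R → parent v ∈ R

    ancestor-closed : ∀ {R} → ParentClosed R → ∀ i {v} → v ∈ R → ancestor v i ∈ R
    ancestor-closed closed zero    v∈R = v∈R
    ancestor-closed closed (suc i) v∈R = ancestor-closed closed i (closed v∈R)

    -- Depths drop strictly up to the root, so the `k` vertices from `v` upwards are distinct; the
    -- induction deletes them from `R` one by one.
    ancestors-count : ∀ k {v R R′} → k ≤ suc (depth v) → R′ ⊆ R →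
                      (∀ {i} → i < k → ancestor v i ∈ R × ancestor v i ∉ R′) →
                      k + ∣ R′ ∣ ≤ ∣ R ∣
    ancestors-count zero    _ R′⊆R _ = p⊆q⇒∣p∣≤∣q∣ R′⊆R
    ancestors-count (suc k) {v} {R} {R′} (s≤s k≤d) R′⊆R anc = ≤-trans
      (s≤s (ancestors-count k {parent v} k≤d′ R′⊆R-v anc′))
      (x∈p⇒∣p-x∣<∣p∣ (proj₁ (anc z<s)))
      where
      k≤d′ : k ≤ suc (depth (parent v))
      k≤d′ = ≤-trans k≤d (≤-trans (m≤n+m∸n (depth v) 1)
        (≤-reflexive (cong suc (sym (depth-ancestor v 1)))))

      R′⊆R-v : R′ ⊆ R - v
      R′⊆R-v w∈R′ = x∈p∧x≢y⇒x∈p-y (R′⊆R w∈R′) λ { refl → proj₂ (anc z<s) w∈R′ }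

      ancestor≢v : ∀ {i} → i < k → ancestor v (suc i) ≢ v
      ancestor≢v {i} i<k eq = <⇒≢ (∸-monoʳ-< {o = 0} z<s (≤-trans i<k k≤d))
        (trans (sym (depth-ancestor v (suc i))) (cong depth eq))

      anc′ : ∀ {i} → i < k → ancestor v (suc i) ∈ R - v × ancestor v (suc i) ∉ R′
      anc′ i<k = x∈p∧x≢y⇒x∈p-y (proj₁ (anc (s<s i<k))) (ancestor≢v i<k) , proj₂ (anc (s<s i<k))

    Below : ℕ → Fin n → Pred (Fin n) 0ℓ
    Below t a w = ∃[ k ] k < t × ancestor w k ≡ a

    below? : ∀ t a → Decidable (Below t a)
    below? t a w = anyUpTo? (λ k → ancestor w k Fin.≟ a) t

    remaining? : ∀ t a (R : Subset n) → Decidable (λ w → w ∈ R × ¬ Below t a w)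
    remaining? t a R w = w ∈? R ×-dec ¬? (below? t a w)

    -- `r` rounds remain after the selection of `a`. As `v` is deepest in `R`, no vertex of `R` lies
    -- more than `r` levels below `a`, so pruning removes the entire subtree of `a` from `R` and
    -- leaves a parent-closed set.
    module Prune (r : ℕ) {R : Subset n} (closed : ParentClosed R)
                 {v} (v∈R : v ∈ R) (deepest : ∀ {w} → w ∈ R → depth w ≤ depth v)
                 (r<d : r < depth v) where

      a : Fin n
      a = ancestor v r

      R′ : Subset n
      R′ = subset (remaining? (suc r) a R)

      R′-closed : ParentClosed R′
      R′-closed {w} w∈R′ with w∈R , ¬below ← ∈-subset⁻ (remaining? (suc r) a R) w∈R′ =
        ∈-subset⁺ (remaining? (suc r) a R) (closed w∈R , ¬below′)
        where
        open ≤-Reasoning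
        -- a is deeper than any (r + 1)-st ancestor of a vertex of R.
        ¬below′ : ¬ Below (suc r) a (parent w)
        ¬below′ (k , _ , eq) with suc k ≤? r
        ... | yes k<r = ¬below (suc k , s<s k<r , eq)
        ... | no  k≮r = <-irrefl refl (begin-strict
          depth a                    ≡⟨ cong depth eq ⟨
          depth (ancestor w (suc k)) ≡⟨ depth-ancestor w (suc k) ⟩
          depth w ∸ suc k            ≤⟨ ∸-mono (deepest w∈R) (≰⇒> k≮r) ⟩
          depth v ∸ suc r            <⟨ ∸-monoʳ-< (n<1+n r) r<d ⟩
          depth v ∸ r                ≡⟨ depth-ancestor v r ⟨
          depth a                    ∎)

      R′-small : suc r + ∣ R′ ∣ ≤ ∣ R ∣
      R′-small = ancestors-count (suc r) (m≤n⇒m≤1+n r<d)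
        (proj₁ ∘ ∈-subset⁻ (remaining? (suc r) a R))
        λ {i} i≤r → ancestor-closed closed i v∈R , λ ∈R′ →
          proj₂ (∈-subset⁻ (remaining? (suc r) a R) ∈R′)
            -- From the `i`-th ancestor of `v`, `r ∸ i` more steps lead to `a`; hence the whole path
            -- from `v` to `a` is pruned.
            (r ∸ i , s≤s (m∸n≤m r i)
            , trans (iterate-iterate parent v i (r ∸ i)) (cong (ancestor v) (m+[n∸m]≡n (≤-pred i≤r))))

      split : ∀ {w} → w ∈ R → Near r (_≡ a) w ⊎ w ∈ R′
      split {w} w∈R with below? (suc r) a w
      ... | yes (k , s≤s k≤r , eq) = inj₁ (near-mono k≤r (near-ancestor k eq))
      ... | no  ¬below             = inj₂ (∈-subset⁺ (remaining? (suc r) a R) (w∈R , ¬below))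

    -- The argument drops by two because Staller selects in every other round.
    capacity : ℕ → ℕ
    capacity (suc (suc t)) = suc (suc t) + capacity t
    capacity _             = 0

    small-empty : ∀ {R : Subset n} → ∣ R ∣ ≤ 0 → ∀ {v} → v ∉ R
    small-empty {R} ∣R∣≤0 v∈R = n≮0 (≤-trans (x∈p⇒∣p-x∣<∣p∣ v∈R) ∣R∣≤0)

    -- The invariant: `R` holds the vertices not yet promised to burn, and spreading alone reaches
    -- all others within `t` rounds.
    strategy : ∀ t {B R} → ParentClosed R → ∣ R ∣ ≤ capacity t →
               (∀ v → Near t (_∈ B) v ⊎ v ∈ R) → rounds⟨ burner , B ⟩≤ t
    strategy 0 _ ∣R∣≤ cover =
      burn-out burner 0 λ v → Sum.fromInj₁ (⊥-elim ∘ small-empty ∣R∣≤) (cover v)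
    strategy 1 _ ∣R∣≤ cover =
      burn-out burner 1 λ v → Sum.fromInj₁ (⊥-elim ∘ small-empty ∣R∣≤) (cover v)
    strategy (suc (suc t)) {B} {R} closed ∣R∣≤ cover with nonempty? R
    ... | no  ¬R = burn-out burner (2 + t) λ v → Sum.fromInj₁ (⊥-elim ∘ ¬R ∘ (v ,_)) (cover v)
    ... | yes (_ , x∈R) with v , v∈R , deepest ← maximiser depth R x∈R | suc t <? depth v
    -- All of `R` is close enough to the root to burn from it in the `suc t` rounds left.
    ...   | no  d≤t = burner-move root λ ⊆B₁ root∈B₁ → burn-out staller (suc t) λ w → Sum.[
              near-map (suc t) ⊆B₁ ∘ near-spread (suc t)
            , (λ w∈R → near-map (suc t) (λ { refl → root∈B₁ })
                         (near-root (≤-trans (deepest w∈R) (≮⇒≥ d≤t)))) ] (cover w)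
    -- Two rounds pass, and each brings the old fire one step closer; `a` still has `suc t` rounds
    -- in which to spread.
    ...   | yes t<d = burner-move a λ ⊆B₁ a∈B₁ → any-move staller λ ⊆B₂ →
              strategy t R′-closed (+-cancelˡ-≤ (2 + t) _ _ (≤-trans R′-small ∣R∣≤)) λ w →
                Sum.map₁ (near-map t ⊆B₂ ∘ near-spread t) (Sum.[
                    inj₁ ∘ near-map (suc t) ⊆B₁ ∘ near-spread (suc t)
                  , Sum.map₁ (near-map (suc t) (λ { refl → a∈B₁ })) ∘ split ] (cover w))
      where open Prune (suc t) closed v∈R deepest t<d

    gameBurningNumber≤ : ∀ t → n ≤ capacity t → gameBurningNumber G ≤ t
    gameBurningNumber≤ t n≤ =
      strategy t (λ _ → ∈⊤) (≤-trans (≤-reflexive (∣⊤∣≡n n)) n≤) (λ _ → inj₂ ∈⊤)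
        (⊃-wellFounded ⊥)

open Game

-- Numerical bounds and the product.

m≤[m/3]*3+2 : ∀ m → m ≤ m / 3 * 3 + 2
m≤[m/3]*3+2 m = begin
  m                 ≡⟨ m≡m%n+[m/n]*n m 3 ⟩
  m % 3 + m / 3 * 3 ≤⟨ +-monoˡ-≤ (m / 3 * 3) (≤-pred (m%n<n m 3)) ⟩
  2 + m / 3 * 3     ≡⟨ +-comm 2 (m / 3 * 3) ⟩
  m / 3 * 3 + 2     ∎
  where open ≤-Reasoning

connected-bound : ∀ {n} (G : Graph n) → Fin n → Connected G → gameBurningNumber G ≤ 6 + n / 3
connected-bound {n} G r conn = gameBurningNumber≤ (6 + q) (begin
  n                                           ≤⟨ m≤[m/3]*3+2 n ⟩
  -- The constant `6` is what `n + 18` affords after division by 3, and it lets `capacity` unfold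
  -- three times whatever `q` is.
  q * 3 + 2                                   ≤⟨ +-monoʳ-≤ (q * 3) (m≤m+n 2 10) ⟩
  q * 3 + 12                                  ≡⟨ rearrange q ⟩
  6 + q + (4 + q + (2 + q))                   ≤⟨ +-monoʳ-≤ (6 + q) (+-monoʳ-≤ (4 + q)
                                                   (m≤m+n (2 + q) (capacity q))) ⟩
  capacity (6 + q)                            ∎)
  where
  open ≤-Reasoning
  open TreeStrategy G (spanningTree G conn r)
  q = n / 3
  rearrange : ∀ q → q * 3 + 12 ≡ 6 + q + (4 + q + (2 + q))
  rearrange = solve 1 (λ q → q :* con 3 :+ con 12
    := con 6 :+ q :+ (con 4 :+ q :+ (con 2 :+ q))) refl
    where open +-*-Solver

-- Unless x or y is a common H-neighbour of u and v, each of them is within distance 1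
-- of {u , v} in G, and the edge uv of G makes a walk of length 3 from x to y.
complement-diameter : ∀ {n} (G H : Graph n) →
  (∀ u v → ¬ Graph.Adj H u v → Step G u v) →
  ∀ {x y} → ¬ Near G 3 (_≡ x) y → ∀ u v → Near H 2 (_≡ u) v
complement-diameter G H G∪H {x} {y} far u v with Graph.adj? H u v
... | yes uv = v , inj₁ refl , u , inj₂ uv , refl
... | no ¬uv with joins x | joins y
  where
  open Graph H
  joins : ∀ w → (Adj u w × Adj w v) ⊎ (Step G w u ⊎ Step G w v)
  joins w with adj? w u | adj? w v
  ... | yes wu | yes wv = inj₁ (Graph.sym H wu , wv)
  ... | no ¬wu | _      = inj₂ (inj₁ (G∪H w u ¬wu))
  ... | _      | no ¬wv = inj₂ (inj₂ (G∪H w v ¬wv))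
... | inj₁ (ux , xv) | _ = x , inj₂ xv , u , inj₂ ux , refl
... | inj₂ _ | inj₁ (uy , yv) = y , inj₂ yv , u , inj₂ uy , refl
... | inj₂ x~ | inj₂ y~ = contradiction (walk x~ y~) far
  where
  flip : ∀ {a b} → Step G a b → Step G b a
  flip = Sum.map sym (Graph.sym G)

  u~v : Step G u v
  u~v = G∪H u v ¬uv

  via : ∀ {a b} → Step G x a → Step G a b → Step G y b → Near G 3 (_≡ x) y
  via xa ab yb = _ , flip yb , _ , ab , _ , xa , refl

  walk : Step G x u ⊎ Step G x v → Step G y u ⊎ Step G y v → Near G 3 (_≡ x) y
  walk (inj₁ xu) (inj₁ yu) = via xu (inj₁ refl) yu
  walk (inj₁ xu) (inj₂ yv) = via xu u~v yv
  walk (inj₂ xv) (inj₁ yu) = via xv (flip u~v) yu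
  walk (inj₂ xv) (inj₂ yv) = via xv (inj₁ refl) yv

diameter≤3? : ∀ {n} (G : Graph n) →
              (∀ u v → Near G 3 (_≡ u) v) ⊎ (∃[ x ] ∃[ y ] ¬ Near G 3 (_≡ x) y)
diameter≤3? {n} G with all? (λ u → all? λ v → near? G 3 (Fin._≟ u) v)
... | yes d≤3 = inj₁ d≤3
... | no  d≰3 with x , far ← ¬∀⟶∃¬ n _ (λ u → all? λ v → near? G 3 (Fin._≟ u) v) d≰3
  = inj₂ (x , ¬∀⟶∃¬ n _ (near? G 3 (Fin._≟ x)) far)

-- Stated for two graphs that jointly cover all pairs, so that it applies in both orders: the
-- complement of `complement G` is not `G` by definition.
far-product : ∀ {n} (G H : Graph n) → Fin n → Connected G →
  (∀ u v → ¬ Graph.Adj H u v → Step G u v) →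
  ∀ {x y} → ¬ Near G 3 (_≡ x) y →
  gameBurningNumber G * gameBurningNumber H ≤ n + 18
far-product {n} G H r conn G∪H far = begin
  gameBurningNumber G * gameBurningNumber H ≤⟨ *-mono-≤ (connected-bound G r conn)
    (gameBurningNumber≤1+ecc H 2 r (complement-diameter G H G∪H far r)) ⟩
  (6 + n / 3) * 3                           ≡⟨ *-distribʳ-+ 3 6 (n / 3) ⟩
  18 + n / 3 * 3                            ≤⟨ +-monoʳ-≤ 18 (m/n*n≤m n 3) ⟩
  18 + n                                    ≡⟨ +-comm 18 n ⟩
  n + 18                                    ∎
  where
  open ≤-Reasoning

corollary12 : (n : ℕ) → 3 ≤ n → (G : Graph n) →
    Connected G → Connected (complement G) →
    gameBurningNumber G * gameBurningNumber (complement G) ≤ n + 18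
corollary12 (suc n) _ G conn conn′ = by-diameter (diameter≤3? G) (diameter≤3? H)
  where
  open Graph G using (Adj; adj?)

  H : Graph (suc n)
  H = complement G

  adj⇒near : ∀ u v → ¬ Adj u v → Step H u v
  adj⇒near u v ¬uv with u Fin.≟ v
  ... | yes u≡v = inj₁ u≡v
  ... | no  u≢v = inj₂ (u≢v , ¬uv)

  -- Decidability of adjacency removes the double negation.
  coadj⇒near : ∀ u v → ¬ Graph.Adj H u v → Step G u v
  coadj⇒near u v ¬uv with u Fin.≟ v | adj? u v
  ... | yes u≡v | _       = inj₁ u≡v
  ... | no  _   | yes uv  = inj₂ uv
  ... | no  u≢v | no ¬uv′ = contradiction (u≢v , ¬uv′) ¬uv

  by-diameter : (∀ u v → Near G 3 (_≡ u) v) ⊎ (∃[ x ] ∃[ y ] ¬ Near G 3 (_≡ x) y) →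
                (∀ u v → Near H 3 (_≡ u) v) ⊎ (∃[ x ] ∃[ y ] ¬ Near H 3 (_≡ x) y) →
                gameBurningNumber G * gameBurningNumber H ≤ suc n + 18
  by-diameter (inj₂ (_ , _ , far)) _ = far-product G H zero conn coadj⇒near far
  by-diameter _ (inj₂ (_ , _ , far)) = ≤-trans
    (≤-reflexive (*-comm (gameBurningNumber G) (gameBurningNumber H)))
    (far-product H G zero conn′ adj⇒near far)
  -- Both values are at most 1 + 3, and 16 is below `n + 18`.
  by-diameter (inj₁ dG) (inj₁ dH) = ≤-trans
    (*-mono-≤ (gameBurningNumber≤1+ecc G 3 zero (dG zero)) (gameBurningNumber≤1+ecc H 3 zero (dH zero)))
    (≤-trans (m≤m+n 16 2) (m≤n+m 18 (suc n)))
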